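{- Let $S_1$ be the set of all nonempty partitions of the form $[\ell+1,\ell^k][i,j]$ with integers $\ell\ge 3$, $k>\ell$, $i,j\ge 0$. Then the family of games Rook on $S_1$ is forced and tame but not miserable.
   Context: A partition is a finite weakly decreasing sequence $\lambda=[\lambda_1,\ldots,\lambda_r]$ of positive integers; exponents denote repetition, so $[\ell+1,\ell^k]$ has one part $\ell+1$ and $k$ parts $\ell$; $[\,]$ is the empty partition, and $\mathbb Y^+$ is the set of nonempty partitions. For $i,j\ge 0$, $\lambda[i,j]=[\lambda_{i+1}-j,\lambda_{i+2}-j,\ldots]$ with trailing nonpositive entries removed. For a moveset $M\subseteq \mathbb Z_{\ge0}^2\setminus\{(0,0)\}$ and $\lambda\in\mathbb Y^+$, the impartial chess game $(M,\lambda)$ starts at $\lambda$, and from a position $\mu\in\mathbb Y^+$ a player may move to $\mu[i,j]$ for any $(i,j)\in M$ with $\mu[i,j]\ne[\,]$. The positions of $(M,\lambda)$ are the partitions reachable from $\lambda$ by zero or more moves. A position is terminal if it has no moves. Rook has moveset $\{(k,0):k\ge1\}\cup\{(0,k):k\ge1\}$. The Sprague-Grundy value of a position $p$ is $\mathrm{mex}$ of the Sprague-Grundy values of the positions reachable in one move ($0$ if $p$ is terminal), where $\mathrm{mex}(S)$ is the least nonnegative integer not in $S$. The misère Grundy value is defined by the same mex recursion at non-terminal positions, but terminal positions have value $1$. A position with Sprague-Grundy value $t$ and misère Grundy value $m$ is called a $(t,m)$-position. A game is forced if each move from a $(0,1)$-position results in a $(1,0)$-position and each move from a $(1,0)$-position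 results in a $(0,1)$-position. A game is tame if it has only $(0,1)$-positions, $(1,0)$-positions, and $(k,k)$-positions with $k\ge0$. A game is miserable if for every position $x$ one of the following holds: (i) $x$ is a $(0,1)$-position or a $(1,0)$-position; (ii) there is no move from $x$ to a $(0,1)$-position or a $(1,0)$-position; (iii) there are moves from $x$ to both a $(0,1)$-position and a $(1,0)$-position. For a moveset $M$ and a set $P\subseteq\mathbb Y^+$, the family $(M,P)$ has one of these properties if $(M,\lambda)$ has it for every $\lambda\in P$, and it does not have the property if $(M,\lambda)$ fails it for at least one $\lambda\in P$. -}

module Defs where

open import Data.Bool.Base using (true; false)
open import Data.Empty using (⊥-elim-irr)
open import Data.Fin.Base as Fin using (Fin; toℕ; fromℕ<; inject)
open import Data.Fin.Properties
  using (¬∀⟶∃¬-smallest; toℕ-fromℕ<; toℕ-inject)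
open import Data.List.Base
  using (List; []; _∷_; [_]; map; filter; drop; length; foldr; upTo;
         replicate; concatMap; cartesianProduct)
open import Data.List.Membership.DecPropositional using () renaming (_∈?_ to ∈?-with)
open import Data.List.Membership.Propositional
  using (_∈_; _∉_; mapWith∈; find; lose)
open import Data.List.Membership.Propositional.Properties
  using (mapWith∈-cong; mapWith∈≗map; ∈-concatMap⁺; ∈-concatMap⁻;
         ∈-cartesianProduct⁺; ∈-upTo⁺; ∈-filter⁺; ∈-filter⁻; ∈-map⁺; ∈-map⁻)
open import Data.List.Relation.Unary.All as All using (All; []; _∷_)
import Data.List.Relation.Unary.All.Properties as All
open import Data.List.Relation.Unary.Any using (here; there)
open import Data.List.Relation.Unary.Linked as Linked using (Linked; []; [-]; _∷_)
import Data.List.Relation.Unary.Linked.Properties as Linked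
open import Data.Nat.Base
  using (ℕ; zero; suc; _∸_; _⊔_; _≤_; _<_; _≥_; z≤n; s≤s; z<s)
open import Data.Nat.Induction using (Acc; acc; <-wellFounded)
open import Data.Nat.ListAction using (sum)
open import Data.Nat.Properties
open import Data.Product.Base using (∃; ∃₂; _×_; _,_; proj₁; proj₂)
open import Data.Sum.Base using (_⊎_; inj₁; inj₂)
open import Function.Base using (_∘_)
open import Relation.Binary.Construct.Closure.ReflexiveTransitive using (Star)
open import Relation.Binary.PropositionalEquality
  using (_≡_; _≢_; refl; sym; trans; cong; subst)
open import Relation.Nullary
  using (¬_; Dec; yes; no; does; contradiction; recompute; _×-dec_; _⊎-dec_)

infix 8 _⟦_,_⟧

-- λ[i,j].  For a weakly decreasing λ the entries with λₖ ≤ j, i.e. those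
-- with λₖ ∸ j ≡ 0, are exactly the trailing nonpositive ones.
_⟦_,_⟧ : List ℕ → ℕ → ℕ → List ℕ
xs ⟦ i , j ⟧ = filter (0 <?_) (map (_∸ j) (drop i xs))

-- The proofs are irrelevant, so two elements of 𝕐⁺ are equal as soon as
-- their lists of parts are.
record 𝕐⁺ : Set where
  constructor mk𝕐⁺
  field
    parts       : List ℕ
    .decreasing : Linked _≥_ parts
    .positive   : All (0 <_) parts
    .nonempty   : parts ≢ []

open 𝕐⁺ public using (parts)

parts-injective : ∀ {μ ν} → parts μ ≡ parts ν → μ ≡ ν
parts-injective refl = refl

drop-linked : ∀ {xs} i → Linked _≥_ xs → Linked _≥_ (drop i xs)
drop-linked zero    l       = l
drop-linked (suc i) []      = []
drop-linked (suc i) [-]     = drop-linked i []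
drop-linked (suc i) (_ ∷ l) = drop-linked i l

⟦⟧-decreasing : ∀ {xs} i j → Linked _≥_ xs → Linked _≥_ (xs ⟦ i , j ⟧)
⟦⟧-decreasing i j l =
  Linked.filter⁺ (0 <?_) (λ x≥y y≥z → ≤-trans y≥z x≥y)
    (Linked.map⁺ (Linked.map (∸-monoˡ-≤ j) (drop-linked i l)))

⟦⟧-positive : ∀ xs i j → All (0 <_) (xs ⟦ i , j ⟧)
⟦⟧-positive xs i j = All.all-filter (0 <?_) (map (_∸ j) (drop i xs))

-- Decidability of membership in the moveset is what makes the Grundy
-- values below computable; classically it is no restriction.
record Moveset : Set₁ where
  field
    Allowed  : ℕ → ℕ → Set
    allowed? : ∀ i j → Dec (Allowed i j)
    nonzero  : ¬ Allowed 0 0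

open Moveset public using (Allowed; allowed?; nonzero)

-- The condition μ[i,j] ≠ [] is implied by ν being nonempty.
Move : Moveset → 𝕐⁺ → 𝕐⁺ → Set
Move M μ ν = ∃₂ λ i j → Allowed M i j × parts ν ≡ parts μ ⟦ i , j ⟧

Position : Moveset → 𝕐⁺ → 𝕐⁺ → Set
Position M lam μ = Star (Move M) lam μ

Terminal : Moveset → 𝕐⁺ → Set
Terminal M μ = ∀ ν → ¬ Move M μ ν

Rook : Moveset
Rook = record
  { Allowed  = λ i j → (1 ≤ i × j ≡ 0) ⊎ (i ≡ 0 × 1 ≤ j)
  ; allowed? = λ i j → ((1 ≤? i) ×-dec (j ≟ 0)) ⊎-dec ((i ≟ 0) ×-dec (1 ≤? j))
  ; nonzero  = λ { (inj₁ (() , _)) ; (inj₂ (_ , ())) }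
  }

asList : ∀ xs → .(Linked _≥_ xs) → .(All (0 <_) xs) → List 𝕐⁺
asList []       _ _ = []
asList (x ∷ xs) d p = [ mk𝕐⁺ (x ∷ xs) d p (λ ()) ]

∈-asList⁺ : ∀ ν xs .d .p → parts ν ≡ xs → ν ∈ asList xs d p
∈-asList⁺ (mk𝕐⁺ []      _ _ ne) _ _ _ refl = ⊥-elim-irr (ne refl)
∈-asList⁺ (mk𝕐⁺ (_ ∷ _) _ _ _)  _ _ _ refl = here refl

∈-asList⁻ : ∀ ν xs .d .p → ν ∈ asList xs d p → parts ν ≡ xs
∈-asList⁻ ν (x ∷ xs) d p (here refl) = refl

maxPart : List ℕ → ℕ
maxPart = foldr _⊔_ 0

-- Pairs with i ≥ length or j ≥ maxPart lead to the empty partition.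
allowedPairs : Moveset → List ℕ → List (ℕ × ℕ)
allowedPairs M xs =
  filter (λ ij → allowed? M (proj₁ ij) (proj₂ ij))
    (cartesianProduct (upTo (length xs)) (upTo (maxPart xs)))

options : Moveset → 𝕐⁺ → List 𝕐⁺
options M (mk𝕐⁺ xs d _ _) =
  concatMap
    (λ (i , j) → asList (xs ⟦ i , j ⟧) (⟦⟧-decreasing i j d) (⟦⟧-positive xs i j))
    (allowedPairs M xs)

private
  filter-zeros : ∀ {xs} j → maxPart xs ≤ j → filter (0 <?_) (map (_∸ j) xs) ≡ []
  filter-zeros {[]}     j _ = refl
  filter-zeros {x ∷ xs} j h
    rewrite m≤n⇒m∸n≡0 (≤-trans (m≤m⊔n x (maxPart xs)) h)
    = filter-zeros {xs} j (≤-trans (m≤n⊔m x (maxPart xs)) h)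

  maxPart-drop : ∀ i xs → maxPart (drop i xs) ≤ maxPart xs
  maxPart-drop zero    xs       = ≤-refl
  maxPart-drop (suc i) []       = z≤n
  maxPart-drop (suc i) (x ∷ xs) =
    ≤-trans (maxPart-drop i xs) (m≤n⊔m x (maxPart xs))

  drop-all : ∀ i (xs : List ℕ) → length xs ≤ i → drop i xs ≡ []
  drop-all zero    []       _       = refl
  drop-all (suc i) []       _       = refl
  drop-all (suc i) (x ∷ xs) (s≤s h) = drop-all i xs h

  i-bound : ∀ xs i j → xs ⟦ i , j ⟧ ≢ [] → i < length xs
  i-bound xs i j ne with i <? length xs
  ... | yes p = p
  ... | no ¬p = contradiction
    (cong (filter (0 <?_) ∘ map (_∸ j)) (drop-all i xs (≮⇒≥ ¬p))) ne

  j-bound : ∀ xs i j → xs ⟦ i , j ⟧ ≢ [] → j < maxPart xs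
  j-bound xs i j ne with j <? maxPart xs
  ... | yes p = p
  ... | no ¬p = contradiction
    (filter-zeros {drop i xs} j (≤-trans (maxPart-drop i xs) (≮⇒≥ ¬p))) ne

  parts≢[] : ∀ ν → parts ν ≢ []
  parts≢[] (mk𝕐⁺ _ _ _ ne) refl = ⊥-elim-irr (ne refl)

∈-options⁺ : ∀ M {μ ν} → Move M μ ν → ν ∈ options M μ
∈-options⁺ M {mk𝕐⁺ xs d _ _} {ν} (i , j , a , eq) =
  ∈-concatMap⁺ _ {xs = allowedPairs M xs}
    (lose {x = i , j}
      (∈-filter⁺ _ (∈-cartesianProduct⁺ (∈-upTo⁺ (i-bound xs i j ne))
                                        (∈-upTo⁺ (j-bound xs i j ne))) a)
      (∈-asList⁺ ν _ (⟦⟧-decreasing i j d) (⟦⟧-positive xs i j) eq))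
  where
  ne : xs ⟦ i , j ⟧ ≢ []
  ne = parts≢[] ν ∘ trans eq

∈-options⁻ : ∀ M {μ ν} → ν ∈ options M μ → Move M μ ν
∈-options⁻ M {mk𝕐⁺ xs d _ _} {ν} m
  with (i , j) , ij∈ , ν∈ ← find (∈-concatMap⁻ _ {xs = allowedPairs M xs} m)
  = i , j
  , proj₂ (∈-filter⁻ _ {xs = cartesianProduct (upTo (length xs)) (upTo (maxPart xs))} ij∈)
  , ∈-asList⁻ ν _ (⟦⟧-decreasing i j d) (⟦⟧-positive xs i j) ν∈

size : 𝕐⁺ → ℕ
size μ = sum (parts μ)

private
  sum-⟦0,⟧ : ∀ xs j → sum (filter (0 <?_) (map (_∸ j) xs)) ≤ sum xs
  sum-⟦0,⟧ []       j = z≤n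
  sum-⟦0,⟧ (x ∷ xs) j with does (0 <? (x ∸ j))
  ... | true  = +-mono-≤ (m∸n≤m x j) (sum-⟦0,⟧ xs j)
  ... | false = m≤n⇒m≤o+n x (sum-⟦0,⟧ xs j)

  sum-drop : ∀ i xs → sum (drop i xs) ≤ sum xs
  sum-drop zero    xs       = ≤-refl
  sum-drop (suc i) []       = z≤n
  sum-drop (suc i) (x ∷ xs) = m≤n⇒m≤o+n x (sum-drop i xs)

  sum-⟦⟧ : ∀ M xs i j → Allowed M i j → xs ≢ [] → All (0 <_) xs →
           sum (xs ⟦ i , j ⟧) < sum xs
  sum-⟦⟧ M []           i       j       a ne _       = contradiction refl ne
  sum-⟦⟧ M (x ∷ xs)     zero    zero    a _  _       = contradiction a (nonzero M)
  sum-⟦⟧ M (zero ∷ xs)  zero    (suc j) a _  (() ∷ _)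
  sum-⟦⟧ M (suc x ∷ xs) zero    (suc j) a _  _       with does (0 <? (x ∸ j))
  ... | true  = s≤s (+-mono-≤ (m∸n≤m x j) (sum-⟦0,⟧ xs (suc j)))
  ... | false = s≤s (m≤n⇒m≤o+n x (sum-⟦0,⟧ xs (suc j)))
  sum-⟦⟧ M (x ∷ xs)     (suc i) j       a _  (p ∷ _) =
    +-mono-<-≤ p (≤-trans (sum-⟦0,⟧ (drop i xs) j) (sum-drop i xs))

move-size : ∀ M {μ ν} → Move M μ ν → size ν < size μ
move-size M {μ@(mk𝕐⁺ xs _ pos ne)} (i , j , a , eq) =
  subst (_< sum xs) (cong sum (sym eq))
    (sum-⟦⟧ M xs i j a (parts≢[] μ) (recompute (All.all? (0 <?_) xs) pos))

IsMex : (ℕ → Set) → ℕ → Set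
IsMex S n = ¬ S n × (∀ k → k < n → S k)

private
  _∈?_ : ∀ n (vs : List ℕ) → Dec (n ∈ vs)
  _∈?_ = ∈?-with _≟_

  ∈⇒≤sum : ∀ {n vs} → n ∈ vs → n ≤ sum vs
  ∈⇒≤sum {n} {vs = v ∷ vs} (here refl) = m≤m+n v (sum vs)
  ∈⇒≤sum     {vs = v ∷ vs} (there m)   = m≤n⇒m≤o+n v (∈⇒≤sum m)

  mex-search : ∀ vs → ∃ λ (i : Fin (suc (suc (sum vs)))) →
               toℕ i ∉ vs × ((j : Fin.Fin′ i) → toℕ (inject j) ∈ vs)
  mex-search vs =
    ¬∀⟶∃¬-smallest (suc (suc (sum vs))) (λ i → toℕ i ∈ vs) (λ i → toℕ i ∈? vs)
      (λ all → 1+n≰n (∈⇒≤sum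
        (subst (_∈ vs) (toℕ-fromℕ< (n<1+n _)) (all (fromℕ< (n<1+n _))))))

-- The search range 0, …, sum vs + 1 contains a number outside vs.
mex : List ℕ → ℕ
mex vs = toℕ (proj₁ (mex-search vs))

mex-isMex : ∀ vs → IsMex (_∈ vs) (mex vs)
mex-isMex vs with i , ∉ , below ← mex-search vs =
  ∉ , λ k k<i → subst (_∈ vs)
    (trans (toℕ-inject (fromℕ< k<i)) (toℕ-fromℕ< k<i)) (below (fromℕ< k<i))

-- The value of a position whose options have the values vs, when terminal
-- positions are given the value t.
fromOptions : ℕ → List ℕ → ℕ
fromOptions t []         = t
fromOptions t vs@(_ ∷ _) = mex vs

option-size : ∀ M μ {ν} → ν ∈ options M μ → size ν < size μ
option-size M μ {ν} ν∈ = move-size M {μ} {ν} (∈-options⁻ M {μ} {ν} ν∈)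

valueAcc : Moveset → ℕ → (μ : 𝕐⁺) → Acc _<_ (size μ) → ℕ
valueAcc M t μ (acc rs) =
  fromOptions t
    (mapWith∈ (options M μ) (λ {ν} ν∈ → valueAcc M t ν (rs (option-size M μ ν∈))))

value : Moveset → ℕ → 𝕐⁺ → ℕ
value M t μ = valueAcc M t μ (<-wellFounded (size μ))

private
  valueAcc-irrelevant : ∀ M t μ (a b : Acc _<_ (size μ)) →
                        valueAcc M t μ a ≡ valueAcc M t μ b
  valueAcc-irrelevant M t μ (acc rs) (acc rs′) =
    cong (fromOptions t)
      (mapWith∈-cong (options M μ)
        (λ {ν} ν∈ → valueAcc M t ν (rs  (option-size M μ ν∈)))
        (λ {ν} ν∈ → valueAcc M t ν (rs′ (option-size M μ ν∈)))
        (λ {ν} ν∈ → valueAcc-irrelevant M t ν (rs  (option-size M μ ν∈))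
                                              (rs′ (option-size M μ ν∈))))

  valueAcc-unfold : ∀ M t μ (a : Acc _<_ (size μ)) →
                    valueAcc M t μ a ≡ fromOptions t (map (value M t) (options M μ))
  valueAcc-unfold M t μ (acc rs) =
    cong (fromOptions t)
      (trans
        (mapWith∈-cong (options M μ)
          (λ {ν} ν∈ → valueAcc M t ν (rs (option-size M μ ν∈)))
          (λ {ν} _  → value M t ν)
          (λ {ν} ν∈ → valueAcc-irrelevant M t ν (rs (option-size M μ ν∈))
                                                (<-wellFounded (size ν))))
        (mapWith∈≗map (value M t) (options M μ)))

value-unfold : ∀ M t μ → value M t μ ≡ fromOptions t (map (value M t) (options M μ))
value-unfold M t μ = valueAcc-unfold M t μ (<-wellFounded (size μ))

value-terminal : ∀ M t μ → Terminal M μ → value M t μ ≡ t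
value-terminal M t μ term =
  trans (value-unfold M t μ) (aux (options M μ) (λ {ν} → ∈-options⁻ M {μ} {ν}))
  where
  aux : ∀ νs → (∀ {ν} → ν ∈ νs → Move M μ ν) →
        fromOptions t (map (value M t) νs) ≡ t
  aux []      _ = refl
  aux (ν ∷ _) f = contradiction (f (here refl)) (term ν)

OptionValue : Moveset → ℕ → 𝕐⁺ → ℕ → Set
OptionValue M t μ v = ∃ λ ν → Move M μ ν × value M t ν ≡ v

value-nonterminal : ∀ M t μ → ¬ Terminal M μ →
                    IsMex (OptionValue M t μ) (value M t μ)
value-nonterminal M t μ ¬term =
  subst (IsMex (OptionValue M t μ)) (sym (value-unfold M t μ))
    (aux (options M μ) (λ ν → ∈-options⁺ M {μ} {ν}) (λ ν → ∈-options⁻ M {μ} {ν}))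
  where
  aux : ∀ νs → (∀ ν → Move M μ ν → ν ∈ νs) → (∀ ν → ν ∈ νs → Move M μ ν) →
        IsMex (OptionValue M t μ) (fromOptions t (map (value M t) νs))
  aux []          f g = contradiction (λ ν m → contradiction (f ν m) (λ ())) ¬term
  aux νs@(_ ∷ _) f g =
      (λ (ν , m , eq) → proj₁ isMex (subst (_∈ vs) eq (∈-map⁺ (value M t) (f ν m))))
    , λ k k<n → let (ν , ν∈ , eq) = ∈-map⁻ (value M t) (proj₂ isMex k k<n)
                in ν , g ν ν∈ , sym eq
    where
    vs : List ℕ
    vs = map (value M t) νs
    isMex : IsMex (_∈ vs) (mex vs)
    isMex = mex-isMex vs

spragueGrundy : Moveset → 𝕐⁺ → ℕ
spragueGrundy M = value M 0

misèreGrundy : Moveset → 𝕐⁺ → ℕ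
misèreGrundy M = value M 1

-- Is M (t , m) x : x is a (t,m)-position.
Is : Moveset → ℕ × ℕ → 𝕐⁺ → Set
Is M (t , m) x = spragueGrundy M x ≡ t × misèreGrundy M x ≡ m

Forced : Moveset → 𝕐⁺ → Set
Forced M lam = ∀ x → Position M lam x → ∀ y → Move M x y →
  (Is M (0 , 1) x → Is M (1 , 0) y) × (Is M (1 , 0) x → Is M (0 , 1) y)

Tame : Moveset → 𝕐⁺ → Set
Tame M lam = ∀ x → Position M lam x →
  Is M (0 , 1) x ⊎ Is M (1 , 0) x ⊎ ∃ λ k → Is M (k , k) x

Miserable : Moveset → 𝕐⁺ → Set
Miserable M lam = ∀ x → Position M lam x →
    (Is M (0 , 1) x ⊎ Is M (1 , 0) x)
  ⊎ (¬ ∃ λ y → Move M x y × (Is M (0 , 1) y ⊎ Is M (1 , 0) y))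
  ⊎ ((∃ λ y → Move M x y × Is M (0 , 1) y) × (∃ λ y → Move M x y × Is M (1 , 0) y))

FamilyHas : (Moveset → 𝕐⁺ → Set) → Moveset → (𝕐⁺ → Set) → Set
FamilyHas Prop M P = ∀ lam → P lam → Prop M lam

FamilyLacks : (Moveset → 𝕐⁺ → Set) → Moveset → (𝕐⁺ → Set) → Set
FamilyLacks Prop M P = ∃ λ lam → P lam × ¬ Prop M lam

S₁ : 𝕐⁺ → Set
S₁ μ = ∃₂ λ ℓ k → ∃₂ λ i j →
  ℓ ≥ 3 × ℓ < k × parts μ ≡ (suc ℓ ∷ replicate k ℓ) ⟦ i , j ⟧

-- Rook on a rectangle is Nim with two heaps, of sizes one less than the sides.
-- If both heaps are at most 1 the position is (0,1) or (1,0), and so are its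
-- options, which gives forcedness.  Every other position has equal values: by
-- induction all its options are tame, and either none of them is (0,1) or
-- (1,0), or the values 0 and 1 both occur among the options under either
-- convention, so that the sets of option values agree.  For [ℓ+1,ℓ^k] with
-- k > ℓ the values 0 and 1 come from the rectangles with heaps (m,m) and
-- (m, m xor 1), where m = ℓ - 1.  Finally [4,3^4] has the (0,1)-option [1] but
-- no (1,0)-option.
module Submission where

open import Defs
open import Data.Empty using (⊥-elim-irr)
open import Data.List.Base using ([]; _∷_; drop; filter; map; replicate)
open import Data.List.Properties using (filter-all; filter-none; map-replicate)
import Data.List.Relation.Unary.All as All
open import Data.List.Relation.Unary.All.Properties using (replicate⁺)
open import Data.List.Relation.Unary.Linked using (Linked; [-]; _∷_)
open import Data.Nat.Base
  using (ℕ; zero; suc; _∸_; _≤_; _<_; _≥_; z≤n; s≤s; z<s; s≤s⁻¹)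
open import Data.Nat.Induction using (<-rec)
open import Data.Nat.Properties
open import Data.Product.Base using (∃; ∃₂; _×_; _,_; proj₁; proj₂)
open import Data.Sum.Base using (_⊎_; inj₁; inj₂; [_,_]′)
open import Function.Base using (_∘_)
open import Relation.Binary.Construct.Closure.ReflexiveTransitive using (ε; _◅_)
open import Relation.Binary.Definitions using (tri<; tri≈; tri>)
open import Relation.Binary.PropositionalEquality
open import Relation.Nullary using (¬_; yes; no; contradiction)

private
  variable
    a b a′ b′ : ℕ

-- Normal and misère values compared through option values

mex-unique : ∀ {S m n} → IsMex S m → IsMex S n → m ≡ n
mex-unique {m = m} {n} (¬m , <m) (¬n , <n) with <-cmp m n
... | tri< m<n _ _ = contradiction (<n m m<n) ¬m
... | tri≈ _ m≡n _ = m≡n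
... | tri> _ _ n<m = contradiction (<m n n<m) ¬n

-- V stands for value M: the latter would be normalised in every
-- with-abstraction, which is prohibitively slow.
module Values
  (M : Moveset) (V : ℕ → 𝕐⁺ → ℕ)
  (V-isMex : ∀ t x y → Move M x y →
             IsMex (λ v → ∃ λ z → Move M x z × V t z ≡ v) (V t x))
  where

  OptionV : ℕ → 𝕐⁺ → ℕ → Set
  OptionV t x v = ∃ λ y → Move M x y × V t y ≡ v

  IsV : ℕ × ℕ → 𝕐⁺ → Set
  IsV (t , m) x = V 0 x ≡ t × V 1 x ≡ m

  option-≢ : ∀ t x y → Move M x y → V t y ≢ V t x
  option-≢ t x y m eq = proj₁ (V-isMex t x y m) (y , m , eq)

  Swapped : 𝕐⁺ → Set
  Swapped x = IsV (0 , 1) x ⊎ IsV (1 , 0) x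

  Equal : 𝕐⁺ → Set
  Equal x = V 0 x ≡ V 1 x

  equal⇒¬swapped : ∀ x → Equal x → ¬ Swapped x
  equal⇒¬swapped x eq (inj₁ (p , q)) = 0≢1+n (trans (sym p) (trans eq q))
  equal⇒¬swapped x eq (inj₂ (p , q)) = 1+n≢0 (trans (sym p) (trans eq q))

  -- A move changes the mex, so `x` and `y` differ in their normal values; among swapped pairs this
  -- leaves only the opposite one.
  swapped-option : ∀ x y → Move M x y → Swapped y →
    (IsV (0 , 1) x → IsV (1 , 0) y) × (IsV (1 , 0) x → IsV (0 , 1) y)
  swapped-option x y m (inj₁ (p , q)) =
      (λ (p′ , _) → contradiction (trans p (sym p′)) (option-≢ 0 x y m))
    , (λ _ → p , q)
  swapped-option x y m (inj₂ (p , q)) =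
      (λ _ → p , q)
    , (λ (p′ , _) → contradiction (trans p (sym p′)) (option-≢ 0 x y m))

  -- Equal sets of option values have equal mex. The move to `y` shows that `x` is not terminal,
  -- since terminal values are prescribed as 0 and 1.
  equal-from-options : ∀ x y → Move M x y →
    (∀ v → OptionV 0 x v → OptionV 1 x v) →
    (∀ v → OptionV 1 x v → OptionV 0 x v) → Equal x
  equal-from-options x y m to from
    with ∉₀ , below₀ ← V-isMex 0 x y m =
    mex-unique (∉₀ ∘ from _ , λ k k< → to k (below₀ k k<)) (V-isMex 1 x y m)

  equal-if-options-equal : ∀ x y → Move M x y →
    (∀ z → Move M x z → Equal z) → Equal x
  equal-if-options-equal x y m equal = equal-from-options x y m
    (λ v (z , mz , eq) → z , mz , trans (sym (equal z mz)) eq)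
    (λ v (z , mz , eq) → z , mz , trans (equal z mz) eq)

  -- Both values 0 and 1 occur among the options under either convention.
  record Covers01 (x : 𝕐⁺) : Set where
    field
      {y z}  : 𝕐⁺
      move-y : Move M x y
      move-z : Move M x z
      kinds  : IsV (0 , 1) y × IsV (1 , 0) z ⊎ IsV (0 , 0) y × IsV (1 , 1) z

    zero-option : ∀ t → t < 2 → OptionV t x 0
    zero-option t t<2 with kinds
    zero-option 0 _ | inj₁ ((p , _) , _) = y , move-y , p
    zero-option 1 _ | inj₁ (_ , (_ , q)) = z , move-z , q
    zero-option 0 _ | inj₂ ((p , _) , _) = y , move-y , p
    zero-option 1 _ | inj₂ ((_ , q) , _) = y , move-y , q
    zero-option (suc (suc _)) (s≤s (s≤s ())) | _

    one-option : ∀ t → t < 2 → OptionV t x 1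
    one-option t t<2 with kinds
    one-option 0 _ | inj₁ (_ , (p , _)) = z , move-z , p
    one-option 1 _ | inj₁ ((_ , q) , _) = y , move-y , q
    one-option 0 _ | inj₂ (_ , (p , _)) = z , move-z , p
    one-option 1 _ | inj₂ (_ , (_ , q)) = z , move-z , q
    one-option (suc (suc _)) (s≤s (s≤s ())) | _

  -- An option with equal values contributes the same number under both conventions. A swapped
  -- option contributes only 0 or 1, and both of these are present on either side anyway.
  equal-if-covers01 : ∀ x → Covers01 x →
    (∀ z → Move M x z → Swapped z ⊎ Equal z) → Equal x
  equal-if-covers01 x c tame = equal-from-options x (Covers01.y c) (Covers01.move-y c) to from
    where
    open Covers01 c using (zero-option; one-option)
    to : ∀ v → OptionV 0 x v → OptionV 1 x v
    to v (z , m , eq) = [ [ (λ (p , _) → subst (OptionV 1 x) (trans (sym p) eq) zero₁)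
                          , (λ (p , _) → subst (OptionV 1 x) (trans (sym p) eq) one₁) ]′
                        , (λ e → z , m , trans (sym e) eq) ]′ (tame z m)
      where
      zero₁ = zero-option 1 (s≤s (s≤s z≤n))
      one₁  = one-option 1 (s≤s (s≤s z≤n))
    from : ∀ v → OptionV 1 x v → OptionV 0 x v
    from v (z , m , eq) = [ [ (λ (_ , q) → subst (OptionV 0 x) (trans (sym q) eq) one₀)
                            , (λ (_ , q) → subst (OptionV 0 x) (trans (sym q) eq) zero₀) ]′
                          , (λ e → z , m , trans e eq) ]′ (tame z m)
      where
      zero₀ = zero-option 0 (s≤s z≤n)
      one₀  = one-option 0 (s≤s z≤n)

  MiserableAt : 𝕐⁺ → Set
  MiserableAt x = Swapped x
    ⊎ (¬ ∃ λ y → Move M x y × Swapped y)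
    ⊎ ((∃ λ y → Move M x y × IsV (0 , 1) y) × (∃ λ y → Move M x y × IsV (1 , 0) y))

  one-kind⇒¬miserable : ∀ x y → Equal x → Move M x y → IsV (0 , 1) y →
    (∀ z → Move M x z → ¬ IsV (1 , 0) z) → ¬ MiserableAt x
  one-kind⇒¬miserable x y equal m is no-10 = λ where
    (inj₁ swapped)                   → equal⇒¬swapped x equal swapped
    (inj₂ (inj₁ none))               → none (y , m , inj₁ is)
    (inj₂ (inj₂ (_ , z , m′ , is′))) → no-10 z m′ is′

-- Rectangles and hooks

replicate-linked : ∀ n c → Linked _≥_ (replicate (suc n) c)
replicate-linked zero    c = [-]
replicate-linked (suc n) c = ≤-refl ∷ replicate-linked n c

-- rect a b is [(a+1)^(b+1)], so that its coordinates are Nim heap sizes, and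
-- hook a b is [a+2,(a+1)^(b+1)].
rect : ℕ → ℕ → 𝕐⁺
rect a b = mk𝕐⁺ (replicate (suc b) (suc a)) (replicate-linked b (suc a))
  (replicate⁺ (suc b) z<s) (λ ())

hook : ℕ → ℕ → 𝕐⁺
hook a b = mk𝕐⁺ (suc (suc a) ∷ replicate (suc b) (suc a))
  (n≤1+n (suc a) ∷ replicate-linked b (suc a))
  (z<s All.∷ replicate⁺ (suc b) z<s) (λ ())

parts≢[] : ∀ x → parts x ≢ []
parts≢[] (mk𝕐⁺ _ _ _ ne) refl = ⊥-elim-irr (ne refl)

drop-replicate : ∀ {A : Set} i n (c : A) → drop i (replicate n c) ≡ replicate (n ∸ i) c
drop-replicate zero    n       c = refl
drop-replicate (suc i) zero    c = refl
drop-replicate (suc i) (suc n) c = drop-replicate i n c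

replicate-⟦⟧ : ∀ n c i j →
  replicate n c ⟦ i , j ⟧ ≡ filter (0 <?_) (replicate (n ∸ i) (c ∸ j))
replicate-⟦⟧ n c i j = cong (filter (0 <?_))
  (trans (cong (map (_∸ j)) (drop-replicate i n c)) (map-replicate (_∸ j) (n ∸ i) c))

filter-replicate-suc : ∀ n c → filter (0 <?_) (replicate n (suc c)) ≡ replicate n (suc c)
filter-replicate-suc n c = filter-all (0 <?_) (replicate⁺ n z<s)

filter-replicate-zero : ∀ n → filter (0 <?_) (replicate n 0) ≡ []
filter-replicate-zero n = filter-none (0 <?_) (replicate⁺ n λ ())

rect-⟦⟧⁺ : ∀ {n c} i j → suc b ≡ n ∸ i → suc a ≡ c ∸ j →
  parts (rect a b) ≡ replicate n c ⟦ i , j ⟧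
rect-⟦⟧⁺ {b} {a} {n} {c} i j p q = sym (trans (replicate-⟦⟧ n c i j)
  (trans (cong₂ (λ n c → filter (0 <?_) (replicate n c)) (sym p) (sym q))
    (filter-replicate-suc (suc b) a)))

rect-⟦⟧⁻ : ∀ x n c i j → parts x ≡ replicate n c ⟦ i , j ⟧ →
  ∃₂ λ a b → x ≡ rect a b × suc a ≡ c ∸ j × suc b ≡ n ∸ i
rect-⟦⟧⁻ x n c i j eq with n ∸ i | c ∸ j | trans eq (replicate-⟦⟧ n c i j)
... | zero  | _     | eq′ = contradiction eq′ (parts≢[] x)
... | suc b | zero  | eq′ = contradiction (trans eq′ (filter-replicate-zero (suc b))) (parts≢[] x)
... | suc b | suc a | eq′ =
  a , b , parts-injective (trans eq′ (filter-replicate-suc (suc b) a)) , refl , refl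

-- Subtracting exactly `c` deletes the equal parts and leaves 1 from the long one: this is the
-- exceptional option `rect 0 0`.
hook-⟦0,⟧⁻ : ∀ x c b j → parts x ≡ (suc c ∷ replicate (suc b) c) ⟦ 0 , j ⟧ →
  x ≡ rect 0 0 ⊎ ∃ λ a → x ≡ hook a b × suc a ≡ c ∸ j
hook-⟦0,⟧⁻ x c b j eq with j ≤? c
... | no j≰c = contradiction (trans eq (trans
    (cong₂ (λ p q → filter (0 <?_) (p ∷ q)) (m≤n⇒m∸n≡0 (≰⇒> j≰c))
      (map-replicate (_∸ j) (suc b) c))
    (trans (cong (λ p → filter (0 <?_) (replicate (suc b) p)) (m≤n⇒m∸n≡0 (≰⇒≥ j≰c)))
      (filter-replicate-zero (suc b))))) (parts≢[] x)
... | yes j≤c with c ∸ j | trans eq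
    (cong₂ (λ p q → filter (0 <?_) (p ∷ q)) (+-∸-assoc 1 j≤c)
      (map-replicate (_∸ j) (suc b) c))
...   | zero  | eq′ = inj₁ (parts-injective
          (trans eq′ (cong (1 ∷_) (filter-replicate-zero (suc b)))))
...   | suc a | eq′ = inj₂ (a , parts-injective
          (trans eq′ (cong (suc (suc a) ∷_) (filter-replicate-suc (suc b) a))) , refl)

suc-≡-∸⇒< : ∀ {m n i} → 1 ≤ i → suc m ≡ suc n ∸ i → m < n
suc-≡-∸⇒< {n = n} {suc i} _ eq = subst (_≤ n) (sym eq) (m∸n≤m n i)

suc-∸-∸ : ∀ {m n} → m ≤ n → suc m ≡ suc n ∸ (n ∸ m)
suc-∸-∸ {m} {n} m≤n =
  sym (trans (+-∸-assoc 1 (m∸n≤m n m)) (cong suc (m∸[m∸n]≡n m≤n)))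

-- Rook moves on rectangles and hooks

row-move : b′ < b → Move Rook (rect a b) (rect a b′)
row-move {b′} {b} b′<b =
    b ∸ b′ , 0 , inj₁ (m<n⇒0<n∸m b′<b , refl)
  , rect-⟦⟧⁺ (b ∸ b′) 0 (suc-∸-∸ (<⇒≤ b′<b)) refl

column-move : a′ < a → Move Rook (rect a b) (rect a′ b)
column-move {a′} {a} a′<a =
    0 , a ∸ a′ , inj₂ (refl , m<n⇒0<n∸m a′<a)
  , rect-⟦⟧⁺ 0 (a ∸ a′) refl (suc-∸-∸ (<⇒≤ a′<a))

data RectOption (a b : ℕ) : 𝕐⁺ → Set where
  row    : b′ < b → RectOption a b (rect a b′)
  column : a′ < a → RectOption a b (rect a′ b)

rect-option : ∀ a b x → Move Rook (rect a b) x → RectOption a b x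
rect-option a b x (i , j , allowed , eq)
  with rect-⟦⟧⁻ x (suc b) (suc a) i j eq | allowed
... | a′ , b′ , refl , refl , q | inj₁ (1≤i , refl) = row (suc-≡-∸⇒< 1≤i q)
... | a′ , b′ , refl , p , refl | inj₂ (refl , 1≤j) = column (suc-≡-∸⇒< 1≤j p)

data HookOption (a b : ℕ) : 𝕐⁺ → Set where
  row    : b′ ≤ b → HookOption a b (rect a b′)
  corner : HookOption a b (rect 0 0)
  column : a′ < a → HookOption a b (hook a′ b)

hook-option : ∀ a b x → Move Rook (hook a b) x → HookOption a b x
-- The first row dropped is the long one, so only `i` of the equal rows go; hence the bound b′ ≤ b
-- is not strict.
hook-option a b x (suc i , j , inj₁ (_ , refl) , eq)
  with _ , b′ , refl , refl , q ← rect-⟦⟧⁻ x (suc b) (suc a) i 0 eq =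
  row (s≤s⁻¹ (subst (_≤ suc b) (sym q) (m∸n≤m (suc b) i)))
hook-option a b x (0 , j , inj₂ (_ , 1≤j) , eq) with hook-⟦0,⟧⁻ x (suc a) b j eq
... | inj₁ refl            = corner
... | inj₂ (a′ , refl , p) = column (suc-≡-∸⇒< 1≤j p)

hook-row-move : b′ ≤ b → Move Rook (hook a b) (rect a b′)
hook-row-move {b′} {b} b′≤b =
    suc (b ∸ b′) , 0 , inj₁ (s≤s z≤n , refl)
  , rect-⟦⟧⁺ (b ∸ b′) 0 (suc-∸-∸ b′≤b) refl

-- Positions reachable from the family

data Shape : 𝕐⁺ → Set where
  rectangle : ∀ a b → Shape (rect a b)
  -- The bound is k > ℓ in heap sizes. It persists because a column move only lowers `a`, and a row
  -- move turns the hook into a rectangle.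
  hooked    : ∀ a b → a < b → Shape (hook a b)

shape-move : ∀ x y → Shape x → Move Rook x y → Shape y
shape-move _ y (rectangle a b) m with rect-option a b y m
... | row {b′} _    = rectangle a b′
... | column {a′} _ = rectangle a′ b
shape-move _ y (hooked a b a<b) m with hook-option a b y m
... | row {b′} _     = rectangle a b′
... | corner         = rectangle 0 0
... | column {a′} lt = hooked a′ b (<-trans lt a<b)

shape-position : ∀ x y → Shape x → Position Rook x y → Shape y
shape-position x y s ε = s
shape-position x y s (_◅_ {j = z} m ms) = shape-position z y (shape-move x z s m) ms

shape-S₁ : ∀ x → S₁ x → Shape x
shape-S₁ x (ℓ , k , suc i , j , _ , _ , eq)
  with a , b , refl , _ ← rect-⟦⟧⁻ x k ℓ i j eq = rectangle a b
shape-S₁ x (ℓ , suc b , zero , j , _ , s≤s ℓ≤b , eq) with hook-⟦0,⟧⁻ x ℓ b j eq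
... | inj₁ refl           = rectangle 0 0
... | inj₂ (a , refl , p) = hooked a b (≤-trans (subst (_≤ ℓ) (sym p) (m∸n≤m ℓ j)) ℓ≤b)

-- The heap size n xor 1.
partner : ℕ → ℕ
partner 0             = 1
partner 1             = 0
partner (suc (suc n)) = suc (suc (partner n))

partner-involutive : ∀ n → partner (partner n) ≡ n
partner-involutive 0             = refl
partner-involutive 1             = refl
partner-involutive (suc (suc n)) = cong (suc ∘ suc) (partner-involutive n)

partner-≢ : ∀ n → partner n ≢ n
partner-≢ (suc (suc n)) eq = partner-≢ n (suc-injective (suc-injective eq))

partner-≤ : ∀ n → partner n ≤ suc n
partner-≤ 0             = ≤-refl
partner-≤ 1             = z≤n
partner-≤ (suc (suc n)) = s≤s (s≤s (partner-≤ n))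

-- `partner` swaps the members of each pair 2q, 2q+1. If m is below `partner n` and differs from n,
-- it lies in an earlier pair, together with `partner m`.
<partner : ∀ m n → m < partner n → m ≡ n ⊎ partner m < n
<partner 0             0             _ = inj₁ refl
<partner (suc m)       0             (s≤s ())
<partner 0             (suc (suc n)) _ = inj₂ (s≤s (s≤s z≤n))
<partner 1             (suc (suc n)) _ = inj₂ (s≤s z≤n)
<partner (suc (suc m)) (suc (suc n)) (s≤s (s≤s m<)) with <partner m n m<
... | inj₁ refl = inj₁ refl
... | inj₂ p    = inj₂ (s≤s (s≤s p))

-- Rook as two-heap Nim

module RookValues
  (V : ℕ → 𝕐⁺ → ℕ)
  (V-isMex : ∀ t x y → Move Rook x y →
             IsMex (λ v → ∃ λ z → Move Rook x z × V t z ≡ v) (V t x))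
  (is00 : V 0 (rect 0 0) ≡ 0 × V 1 (rect 0 0) ≡ 1)
  (is01 : V 0 (rect 0 1) ≡ 1 × V 1 (rect 0 1) ≡ 0)
  (is10 : V 0 (rect 1 0) ≡ 1 × V 1 (rect 1 0) ≡ 0)
  (is11 : V 0 (rect 1 1) ≡ 0 × V 1 (rect 1 1) ≡ 1)
  where

  open Values Rook V V-isMex

  -- The mirror strategy: whichever heap was reduced, reducing the other to match gives a smaller
  -- square of value 0, so no option has value 0.
  SG-square : ∀ a → V 0 (rect a a) ≡ 0
  SG-square = <-rec _ go
    where
    go : ∀ a → (∀ {a′} → a′ < a → V 0 (rect a′ a′) ≡ 0) →
         V 0 (rect a a) ≡ 0
    go 0       _   = proj₁ is00
    go (suc a) rec =
      mex-unique (V-isMex 0 (rect (suc a) (suc a)) (rect a (suc a)) (column-move ≤-refl))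
        ((λ (y , m , eq) → excluded y (rect-option (suc a) (suc a) y m) eq) , λ _ ())
      where
      excluded : ∀ y → RectOption (suc a) (suc a) y → V 0 y ≢ 0
      excluded _ (row {b′} lt) eq =
        option-≢ 0 (rect (suc a) b′) (rect b′ b′) (column-move lt) (trans (rec lt) (sym eq))
      excluded _ (column {a′} lt) eq =
        option-≢ 0 (rect a′ (suc a)) (rect a′ a′) (row-move lt) (trans (rec lt) (sym eq))

  square-option : ∀ a b → a ≢ b → ∃ λ c → Move Rook (rect a b) (rect c c)
  square-option a b a≢b with <-cmp a b
  ... | tri< a<b _ _ = a , row-move a<b
  ... | tri≈ _ a≡b _ = contradiction a≡b a≢b
  ... | tri> _ _ b<a = b , column-move b<a

  -- An unequal pair of heaps has a square option, of value 0. Any option is either a square or can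
  -- be answered by a move to a smaller partnered pair, of value 1 by induction; so no option has
  -- value 1.
  SG-partner : ∀ a → V 0 (rect a (partner a)) ≡ 1
  SG-partner = <-rec _ go
    where
    go : ∀ a → (∀ {a′} → a′ < a → V 0 (rect a′ (partner a′)) ≡ 1) →
         V 0 (rect a (partner a)) ≡ 1
    go a rec with c , move-c ← square-option a (partner a) (partner-≢ a ∘ sym) =
      mex-unique (V-isMex 0 (rect a (partner a)) (rect c c) move-c)
        ( (λ (y , m , eq) → excluded y (rect-option a (partner a) y m) eq)
        , λ { 0 _ → rect c c , move-c , SG-square c ; (suc _) (s≤s ()) })
      where
      excluded : ∀ y → RectOption a (partner a) y → V 0 y ≢ 1
      excluded _ (row {b′} lt) eq with <partner b′ a lt
      ... | inj₁ refl with () ← trans (sym (SG-square a)) eq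
      ... | inj₂ lt′ = option-≢ 0 (rect a b′) (rect (partner b′) b′) (column-move lt′)
        (trans (subst (λ b → V 0 (rect (partner b′) b) ≡ 1)
                      (partner-involutive b′) (rec lt′))
          (sym eq))
      excluded _ (column {a′} lt) eq
        -- Reading `a` as `partner (partner a)` exchanges the roles of the two heaps.
        with <partner a′ (partner a) (subst (a′ <_) (sym (partner-involutive a)) lt)
      ... | inj₁ refl with () ← trans (sym (SG-square (partner a))) eq
      ... | inj₂ lt′ = option-≢ 0 (rect a′ (partner a)) (rect a′ (partner a′)) (row-move lt′)
        (trans (rec lt) (sym eq))

  -- Both values of rectangles and hooks

  swapped-rect : a < 2 → b < 2 → Swapped (rect a b)
  swapped-rect {0} {0} _ _ = inj₁ is00
  swapped-rect {0} {1} _ _ = inj₂ is01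
  swapped-rect {1} {0} _ _ = inj₂ is10
  swapped-rect {1} {1} _ _ = inj₁ is11
  swapped-rect {suc (suc _)} {_} (s≤s (s≤s ())) _
  swapped-rect {_} {suc (suc _)} _ (s≤s (s≤s ()))

  -- With one heap fixed at 0 or 1, setting the other to 0 and to 1 yields one position of each
  -- swapped kind; the order depends on the fixed heap.
  small-rows : ∀ x a → a < 2 → (∀ {b} → b < 2 → Move Rook x (rect a b)) → Covers01 x
  small-rows x 0 _ move = record
    { move-y = move {0} (s≤s z≤n) ; move-z = move {1} (s≤s (s≤s z≤n))
    ; kinds = inj₁ (is00 , is01) }
  small-rows x 1 _ move = record
    { move-y = move {1} (s≤s (s≤s z≤n)) ; move-z = move {0} (s≤s z≤n)
    ; kinds = inj₁ (is11 , is10) }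
  small-rows x (suc (suc _)) (s≤s (s≤s ())) _

  small-columns : ∀ x b → b < 2 → (∀ {a} → a < 2 → Move Rook x (rect a b)) → Covers01 x
  small-columns x 0 _ move = record
    { move-y = move {0} (s≤s z≤n) ; move-z = move {1} (s≤s (s≤s z≤n))
    ; kinds = inj₁ (is00 , is10) }
  small-columns x 1 _ move = record
    { move-y = move {1} (s≤s (s≤s z≤n)) ; move-z = move {0} (s≤s z≤n)
    ; kinds = inj₁ (is11 , is01) }
  small-columns x (suc (suc _)) (s≤s (s≤s ())) _

  Large : ℕ → ℕ → Set
  Large a b = 2 ≤ a ⊎ 2 ≤ b

  equal-rect : ∀ a b → Large a b → Equal (rect a b)
  -- Column moves lower `a` and row moves lower `b`, hence an outer induction on `a` for all `b` and
  -- an inner one on `b`.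
  equal-rect = <-rec _ λ a rec-a → <-rec _ λ b rec-b → go a b rec-a rec-b
    where
    go : ∀ a b →
         (∀ {a′} → a′ < a → ∀ b → Large a′ b → Equal (rect a′ b)) →
         (∀ {b′} → b′ < b → Large a b′ → Equal (rect a b′)) →
         Large a b → Equal (rect a b)
    go a b rec-a rec-b large with a <? 2 | b <? 2
    go a b rec-a rec-b (inj₁ 2≤a) | yes a<2 | yes b<2 = contradiction 2≤a (<⇒≱ a<2)
    go a b rec-a rec-b (inj₂ 2≤b) | yes a<2 | yes b<2 = contradiction 2≤b (<⇒≱ b<2)
    go a b rec-a rec-b large | yes a<2 | no b≮2 =
      equal-if-covers01 (rect a b)
        (small-rows (rect a b) a a<2 λ b′<2 → row-move (<-≤-trans b′<2 (≮⇒≥ b≮2)))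
        (λ y m → tame y (rect-option a b y m))
      where
      tame : ∀ y → RectOption a b y → Swapped y ⊎ Equal y
      tame _ (column lt) = inj₂ (rec-a lt b (inj₂ (≮⇒≥ b≮2)))
      tame _ (row {b′} lt) with b′ <? 2
      ... | yes b′<2 = inj₁ (swapped-rect a<2 b′<2)
      ... | no  b′≮2 = inj₂ (rec-b lt (inj₂ (≮⇒≥ b′≮2)))
    go a b rec-a rec-b large | no a≮2 | yes b<2 =
      equal-if-covers01 (rect a b)
        (small-columns (rect a b) b b<2 λ a′<2 → column-move (<-≤-trans a′<2 (≮⇒≥ a≮2)))
        (λ y m → tame y (rect-option a b y m))
      where
      tame : ∀ y → RectOption a b y → Swapped y ⊎ Equal y
      tame _ (row lt) = inj₂ (rec-b lt (inj₁ (≮⇒≥ a≮2)))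
      tame _ (column {a′} lt) with a′ <? 2
      ... | yes a′<2 = inj₁ (swapped-rect a′<2 b<2)
      ... | no  a′≮2 = inj₂ (rec-a lt b (inj₁ (≮⇒≥ a′≮2)))
    go a b rec-a rec-b large | no a≮2 | no b≮2 =
      -- Here `rect a 0` only witnesses that a move exists. A move changes one heap, so the other
      -- stays at least 2 and no option is swapped.
      equal-if-options-equal (rect a b) (rect a 0)
        (row-move (<-≤-trans (s≤s z≤n) (≮⇒≥ b≮2)))
        (λ y m → equal y (rect-option a b y m))
      where
      equal : ∀ y → RectOption a b y → Equal y
      equal _ (row lt)    = rec-b lt (inj₁ (≮⇒≥ a≮2))
      equal _ (column lt) = rec-a lt b (inj₂ (≮⇒≥ b≮2))

  data RectClass (a b : ℕ) : Set where
    small : a < 2 → b < 2 → RectClass a b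
    large : Equal (rect a b) → RectClass a b

  rect-class : ∀ a b → RectClass a b
  rect-class a b with a <? 2 | b <? 2
  ... | yes a<2 | yes b<2 = small a<2 b<2
  ... | no  a≮2 | _       = large (equal-rect a b (inj₁ (≮⇒≥ a≮2)))
  ... | yes _   | no b≮2  = large (equal-rect a b (inj₂ (≮⇒≥ b≮2)))

  tame-rect : ∀ a b → Swapped (rect a b) ⊎ Equal (rect a b)
  tame-rect a b with rect-class a b
  ... | small a<2 b<2 = inj₁ (swapped-rect a<2 b<2)
  ... | large equal   = inj₂ equal

  -- Dropping the long row and possibly more keeps `a` and allows any second heap up to `b`. For a ≥
  -- 2 the resulting rectangles have equal values, so their normal values 0 and 1 are misère values
  -- too.
  hook-covers01 : ∀ a b → a < b → Covers01 (hook a b)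
  hook-covers01 a b a<b with a <? 2
  ... | yes a<2 = small-rows (hook a b) a a<2
    λ b′<2 → hook-row-move (≤-trans (s≤s⁻¹ b′<2) (≤-trans (s≤s z≤n) a<b))
  ... | no a≮2 = record
    { move-y = hook-row-move {a} (<⇒≤ a<b)
    -- As `partner a` can be a + 1, this needs a < b.
    ; move-z = hook-row-move {partner a} (≤-trans (partner-≤ a) a<b)
    ; kinds = inj₂
        ( (SG-square a , trans (sym (equal-rect a a (inj₁ 2≤a))) (SG-square a))
        , (SG-partner a , trans (sym (equal-rect a (partner a) (inj₁ 2≤a))) (SG-partner a)))
    }
    where 2≤a = ≮⇒≥ a≮2

  equal-hook : ∀ a b → a < b → Equal (hook a b)
  equal-hook a b = <-rec (λ a → a < b → Equal (hook a b)) go a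
    where
    go : ∀ a → (∀ {a′} → a′ < a → a′ < b → Equal (hook a′ b)) →
         a < b → Equal (hook a b)
    go a rec a<b = equal-if-covers01 (hook a b) (hook-covers01 a b a<b)
      λ y m → tame y (hook-option a b y m)
      where
      tame : ∀ y → HookOption a b y → Swapped y ⊎ Equal y
      tame _ (row {b′} _) = tame-rect a b′
      tame _ corner       = tame-rect 0 0
      tame _ (column lt)  = inj₂ (rec lt (<-trans lt a<b))

  -- Forcedness, tameness and the failure of miserability

  forced-step : ∀ x y → Shape x → Move Rook x y →
    (IsV (0 , 1) x → IsV (1 , 0) y) × (IsV (1 , 0) x → IsV (0 , 1) y)
  forced-step _ y (hooked a b a<b) _ =
      (λ is → contradiction (inj₁ is) (equal⇒¬swapped (hook a b) (equal-hook a b a<b)))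
    , (λ is → contradiction (inj₂ is) (equal⇒¬swapped (hook a b) (equal-hook a b a<b)))
  forced-step _ y (rectangle a b) m with rect-class a b
  ... | large equal =
      (λ is → contradiction (inj₁ is) (equal⇒¬swapped (rect a b) equal))
    , (λ is → contradiction (inj₂ is) (equal⇒¬swapped (rect a b) equal))
  ... | small a<2 b<2 = swapped-option (rect a b) y m (swapped y (rect-option a b y m))
    where
    swapped : ∀ y → RectOption a b y → Swapped y
    swapped _ (row lt)    = swapped-rect a<2 (<-trans lt b<2)
    swapped _ (column lt) = swapped-rect (<-trans lt a<2) b<2

  tame-shape : ∀ x → Shape x → IsV (0 , 1) x ⊎ IsV (1 , 0) x ⊎ ∃ λ k → IsV (k , k) x
  tame-shape _ (hooked a b a<b) = inj₂ (inj₂ (_ , refl , sym (equal-hook a b a<b)))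
  tame-shape _ (rectangle a b) with tame-rect a b
  ... | inj₁ (inj₁ is) = inj₁ is
  ... | inj₁ (inj₂ is) = inj₂ (inj₁ is)
  ... | inj₂ equal     = inj₂ (inj₂ (_ , refl , sym equal))

  -- Since a ≥ 2, row moves reach only rectangles with equal values. Column moves reach hooks, again
  -- with equal values, or the corner, which is (0,1).
  no-10-option : ∀ a b → 2 ≤ a → a < b → ∀ y → Move Rook (hook a b) y → ¬ IsV (1 , 0) y
  no-10-option a b 2≤a a<b y m is with hook-option a b y m
  ... | row {b′} _ =
    equal⇒¬swapped (rect a b′) (equal-rect a b′ (inj₁ 2≤a)) (inj₂ is)
  ... | column {a′} lt =
    equal⇒¬swapped (hook a′ b) (equal-hook a′ b (<-trans lt a<b)) (inj₂ is)
  ... | corner = 0≢1+n (trans (sym (proj₁ is00)) (proj₁ is))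

  ¬miserable-[4,3⁴] : ¬ MiserableAt (hook 2 3)
  ¬miserable-[4,3⁴] = one-kind⇒¬miserable (hook 2 3) (rect 0 0)
    (equal-hook 2 3 ≤-refl)
    -- Removing three columns from [4,3^4] leaves [1].
    (0 , 3 , inj₂ (refl , s≤s z≤n) , refl)
    is00
    (no-10-option 2 3 ≤-refl ≤-refl)

-- The values of [1], [1,1], [2] and [2,2] are found by evaluation; all others come from the mex
-- property.
open RookValues (value Rook) (λ t x y m → value-nonterminal Rook t x λ term → term y m)
  (refl , refl) (refl , refl) (refl , refl) (refl , refl)

theorem4p12 : FamilyHas Forced Rook S₁ × FamilyHas Tame Rook S₁ × FamilyLacks Miserable Rook S₁
theorem4p12 =
    (λ lam s x pos y → forced-step x y (shape-position lam x (shape-S₁ lam s) pos))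
  , (λ lam s x pos → tame-shape x (shape-position lam x (shape-S₁ lam s) pos))
  -- The least admissible choice: ℓ = 3 and k = 4 with nothing removed.
  , hook 2 3 , (3 , 4 , 0 , 0 , ≤-refl , ≤-refl , refl)
  , (λ miserable → ¬miserable-[4,3⁴] (miserable (hook 2 3) ε))
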